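{- Let $n\ge 3$ and $2\le k<n$ be integers. Then $$\operatorname{Det}(\mathrm{PX}(n,k))=\begin{cases}\lceil n/k\rceil, & \text{if } k\neq n/2,\\ \lceil n/k\rceil+1=3, & \text{if } k=n/2.\end{cases}$$
   Context: For integers $n\ge 3$ and $1\le k<n$, the Praeger–Xu graph $\mathrm{PX}(n,k)$ is the simple graph with vertex set $\mathbb Z_n\times\mathbb Z_2^k$; a vertex is written $(i,x)$ with $x=x_0x_1\cdots x_{k-1}$ a bitstring of length $k$. Two vertices $(i,x)$ and $(j,y)$ are adjacent if and only if (after possibly swapping the two vertices) $j=i+1$ in $\mathbb Z_n$ and $x=az_1\cdots z_{k-1}$, $y=z_1\cdots z_{k-1}b$ for some bits $a,b,z_1,\dots,z_{k-1}\in\mathbb Z_2$. For a graph $G$, a set $S\subseteq V(G)$ is a determining set if the only automorphism of $G$ fixing every vertex of $S$ is the identity; $\operatorname{Det}(G)$, the determining number, is the minimum size of a determining set. -}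

module Defs where

open import Data.Nat using (ℕ; zero; suc; _+_; _*_; _≤_; _/_)
open import Data.Fin using (Fin; toℕ)
open import Data.Bool using (Bool)
open import Data.Vec using (Vec; _∷_; _∷ʳ_)
open import Data.Product using (Σ; _×_; ∃; _,_)
open import Data.Sum using (_⊎_)
open import Data.Unit using (⊤)
open import Data.List using (List; length)
open import Data.List.Membership.Propositional using (_∈_)
open import Data.List.Relation.Unary.Unique.Propositional using (Unique)
open import Function.Bundles using (_↔_; Inverse; _⇔_)
open import Relation.Binary.PropositionalEquality using (_≡_)

-- Vertex set of PX(n,k): ℤ_n × ℤ_2^k, with ℤ_n modelled as Fin n
-- and bitstrings x = x₀x₁⋯x_{k-1} as Vec Bool k.
Vertex : ℕ → ℕ → Set
Vertex n k = Fin n × Vec Bool k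

IsSucc : {n : ℕ} → Fin n → Fin n → Set
IsSucc {n} i j = (suc (toℕ i) ≡ toℕ j) ⊎ ((suc (toℕ i) ≡ n) × (toℕ j ≡ 0))

-- x = a z₁⋯z_{k-1} and y = z₁⋯z_{k-1} b for some bits a, b, z₁,…,z_{k-1}
-- (for k = 0 the condition is vacuous; k ≥ 1 throughout the paper)
Shift : {k : ℕ} → Vec Bool k → Vec Bool k → Set
Shift {zero}  x y = ⊤
Shift {suc m} x y =
  Σ Bool λ a → Σ Bool λ b → Σ (Vec Bool m) λ z → (x ≡ a ∷ z) × (y ≡ z ∷ʳ b)

Arc : {n k : ℕ} → Vertex n k → Vertex n k → Set
Arc (i , x) (j , y) = IsSucc i j × Shift x y

Adj : (n k : ℕ) → Vertex n k → Vertex n k → Set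
Adj n k u v = Arc u v ⊎ Arc v u

record Automorphism (n k : ℕ) : Set where
  field
    perm     : Vertex n k ↔ Vertex n k
    preserve : ∀ u v → Adj n k u v ⇔ Adj n k (Inverse.to perm u) (Inverse.to perm v)

IsDeterminingSet : (n k : ℕ) → List (Vertex n k) → Set
IsDeterminingSet n k S =
  (φ : Automorphism n k) →
  (∀ v → v ∈ S → Inverse.to (Automorphism.perm φ) v ≡ v) →
  ∀ v → Inverse.to (Automorphism.perm φ) v ≡ v

DetNumberIs : (n k d : ℕ) → Set
DetNumberIs n k d =
  (Σ (List (Vertex n k)) λ S → Unique S × (length S ≡ d) × IsDeterminingSet n k S)
  × (∀ (S : List (Vertex n k)) → Unique S → IsDeterminingSet n k S → d ≤ length S)

-- ⌈ n / k ⌉ (k ≥ 1); value 0 for k = 0 is irrelevant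
ceilDiv : ℕ → ℕ → ℕ
ceilDiv n zero    = 0
ceilDiv n (suc k) = (n + k) / suc k

{-# OPTIONS --safe #-}
-- Lower bound: flipping the bit at one position of ℤ_n is an automorphism, so the windows of a
-- determining set cover ℤ_n. If n = 2k and two windows cover ℤ_n, they are antipodal, and the
-- reflection fixing both of them can be corrected by bit flips so that it fixes the two vertices.
-- Upper bound: for n ≠ 4 two neighbours of v lie on the same side of v (both out or both in) iff
-- they have a common neighbour other than v, so an automorphism preserves all arcs or reverses
-- them all. Reversal is a reflection on the windows, which is excluded by fixing two windows that
-- are neither equal nor antipodal. An automorphism preserving arcs changes a bit at position j
-- depending only on j and that bit, hence is the identity once its fixed windows cover ℤ_n.
-- For n = 4 there are further 4-cycles and further automorphisms; these two graphs are settled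
-- by checking that an explicit set propagates: each further vertex in a list is singled out by
-- its relations to the earlier ones.
module Submission where

open import Defs
open import Data.Bool using (Bool; true; false; not; _xor_; if_then_else_)
open import Data.Empty using (⊥; ⊥-elim)
open import Data.Fin using (Fin; toℕ; zero; suc; combine; fromℕ<)
open import Data.Fin.Properties using (toℕ-fromℕ<; toℕ-injective; toℕ<n; any?; combine-injective; injective⇒≤)
open import Data.List using (List; []; _∷_; length; lookup; applyUpTo; allFin; cartesianProduct; cartesianProductWith)
open import Data.List.Properties using (length-applyUpTo)
open import Data.List.Membership.Propositional using (_∈_; lose)
open import Data.List.Membership.Propositional.Properties using (∈-applyUpTo⁺; ∈-allFin; ∈-cartesianProduct⁺; ∈-cartesianProductWith⁺)
open import Data.List.Relation.Unary.All as All using (All; []; _∷_)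
open import Data.List.Relation.Unary.AllPairs using ([]; _∷_)
open import Data.List.Relation.Unary.Any as Any using (here; there; index)
open import Data.List.Relation.Unary.Any.Properties using (lookup-index)
open import Data.List.Relation.Unary.Unique.Propositional using (Unique)
open import Data.List.Relation.Unary.Unique.Propositional.Properties using (applyUpTo⁺₁)
open import Data.Nat
open import Data.Nat.DivMod
open import Data.Nat.Properties
open import Data.Nat.Tactic.RingSolver using (solve-∀)
open import Data.Product using (∃; _×_; _,_; proj₁; proj₂)
open import Data.Sum using (_⊎_; inj₁; inj₂; [_,_]′)
open import Data.Unit using (tt)
open import Data.Vec using (Vec; []; _∷_; _∷ʳ_)
open import Function using (_∘_)
open import Relation.Binary.PropositionalEquality
open import Relation.Nullary
open import Relation.Nullary.Decidable using (dec-true; dec-false; map′; _×-dec_; _⊎-dec_; _→-dec_; ¬?; toWitness)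
open import Relation.Binary.Definitions using (tri<; tri≈; tri>)
open import Function.Bundles using (Inverse; Equivalence; mk↔ₛ′; mk⇔)
open import Function.Construct.Composition using (_↔-∘_; _⇔-∘_)
open import Data.Bool.Properties using (not-¬)
open import Data.Fin.Patterns
import Data.Bool as Bool
import Data.Fin as Fin
import Data.Product.Properties as Product
import Data.Vec.Properties as Vec

-- Bitstrings as functions of the position

-- Total on `ℕ`, with default `false` past the end, so that positions can be added without bound
-- proofs.
bit : ∀ {k} → Vec Bool k → ℕ → Bool
bit []      _       = false
bit (a ∷ _) zero    = a
bit (_ ∷ x) (suc p) = bit x p

fromBits : ∀ k → (ℕ → Bool) → Vec Bool k
fromBits zero    f = []
fromBits (suc k) f = f 0 ∷ fromBits k (f ∘ suc)

bit-fromBits : ∀ {k} f {p} → p < k → bit (fromBits k f) p ≡ f p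
bit-fromBits f {zero}  (s≤s _)   = refl
bit-fromBits f {suc p} (s≤s p<k) = bit-fromBits (f ∘ suc) p<k

bit-ext : ∀ {k} {x y : Vec Bool k} → (∀ p → p < k → bit x p ≡ bit y p) → x ≡ y
bit-ext {x = []}    {[]}    h = refl
bit-ext {x = a ∷ x} {b ∷ y} h = cong₂ _∷_ (h 0 z<s) (bit-ext λ p p<k → h (suc p) (s<s p<k))

bit-∷ʳ-< : ∀ {m} (z : Vec Bool m) b {p} → p < m → bit (z ∷ʳ b) p ≡ bit z p
bit-∷ʳ-< (a ∷ z) b {zero}  _         = refl
bit-∷ʳ-< (a ∷ z) b {suc p} (s≤s p<m) = bit-∷ʳ-< z b p<m

bit-∷ʳ-last : ∀ {m} (z : Vec Bool m) b → bit (z ∷ʳ b) m ≡ b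
bit-∷ʳ-last []      b = refl
bit-∷ʳ-last (a ∷ z) b = bit-∷ʳ-last z b

Shift⇒bits : ∀ {k} {x y : Vec Bool k} → Shift x y → ∀ p → suc p < k → bit x (suc p) ≡ bit y p
Shift⇒bits {suc m} (a , b , z , refl , refl) p (s≤s p<m) = sym (bit-∷ʳ-< z b p<m)

bits⇒Shift : ∀ {k} {x y : Vec Bool k} → (∀ p → suc p < k → bit x (suc p) ≡ bit y p) → Shift x y
bits⇒Shift {zero}              h = tt
-- The free bits are the head of `x` and the last bit of `y`; only the overlap is constrained.
bits⇒Shift {suc m} {a ∷ z} {y} h = a , bit y m , z , refl , bit-ext eq
  where
  eq : ∀ p → p < suc m → bit y p ≡ bit (z ∷ʳ bit y m) p
  eq p (s≤s p≤m) with m≤n⇒m<n∨m≡n p≤m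
  ... | inj₁ p<m  = sym (trans (bit-∷ʳ-< z _ p<m) (h p (s<s p<m)))
  ... | inj₂ refl = sym (bit-∷ʳ-last z _)

-- Congruence modulo n

module Cyclic (n : ℕ) {{_ : NonZero n}} where

  infix 4 _≈_ _≉_
  -- Two-sided, so that cancellation needs no subtraction.
  record _≈_ (x y : ℕ) : Set where
    constructor congruent
    field
      a b      : ℕ
      equality : x + a * n ≡ y + b * n

  _≉_ : ℕ → ℕ → Set
  x ≉ y = ¬ x ≈ y

  ≈-reflexive : ∀ {x y} → x ≡ y → x ≈ y
  ≈-reflexive refl = congruent 0 0 refl

  ≈-refl : ∀ {x} → x ≈ x
  ≈-refl = ≈-reflexive refl

  ≈-sym : ∀ {x y} → x ≈ y → y ≈ x
  ≈-sym (congruent a b e) = congruent b a (sym e)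

  +-cong-≈ : ∀ {x y u v} → x ≈ y → u ≈ v → x + u ≈ y + v
  +-cong-≈ {x} {y} {u} {v} (congruent a b e) (congruent c d e′) = congruent (a + c) (b + d) (begin
    x + u + (a + c) * n         ≡⟨ shuffle x u a c n ⟩
    (x + a * n) + (u + c * n)   ≡⟨ cong₂ _+_ e e′ ⟩
    (y + b * n) + (v + d * n)   ≡⟨ shuffle y v b d n ⟨
    y + v + (b + d) * n         ∎)
    where
    open ≡-Reasoning
    shuffle : ∀ x u a c n → x + u + (a + c) * n ≡ (x + a * n) + (u + c * n)
    shuffle = solve-∀

  +-cancelˡ-≈ : ∀ w {x y} → w + x ≈ w + y → x ≈ y
  +-cancelˡ-≈ w {x} {y} (congruent a b e) = congruent a b
    (+-cancelˡ-≡ w _ _ (trans (sym (+-assoc w x _)) (trans e (+-assoc w y _))))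

  -- Adding the two congruences gives `x + y ≈ y + z`, and `y` cancels.
  ≈-trans : ∀ {x y z} → x ≈ y → y ≈ z → x ≈ z
  ≈-trans {x} {y} {z} p q =
    +-cancelˡ-≈ y (subst (_≈ y + z) (+-comm x y) (+-cong-≈ p q))

  +-cancelʳ-≈ : ∀ w {x y} → x + w ≈ y + w → x ≈ y
  +-cancelʳ-≈ w {x} {y} e = +-cancelˡ-≈ w (subst₂ _≈_ (+-comm x w) (+-comm y w) e)

  suc-cong-≈ : ∀ {x y} → x ≈ y → suc x ≈ suc y
  suc-cong-≈ = +-cong-≈ (≈-refl {1})

  suc-injective-≈ : ∀ {x y} → suc x ≈ suc y → x ≈ y
  suc-injective-≈ = +-cancelˡ-≈ 1

  n*≈0 : ∀ a → n * a ≈ 0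
  n*≈0 a = congruent 0 a (trans (+-identityʳ _) (*-comm n a))

  %-≈ : ∀ t → t % n ≈ t
  %-≈ t = congruent (t / n) 0 (trans (sym (m≡m%n+[m/n]*n t n)) (sym (+-identityʳ t)))

  ≈⇒%≡ : ∀ {x y} → x ≈ y → x % n ≡ y % n
  ≈⇒%≡ {x} {y} (congruent a b e) = begin
    x % n             ≡⟨ [m+kn]%n≡m%n x a n ⟨
    (x + a * n) % n   ≡⟨ cong (_% n) e ⟩
    (y + b * n) % n   ≡⟨ [m+kn]%n≡m%n y b n ⟩
    y % n             ∎
    where open ≡-Reasoning

  %≡⇒≈ : ∀ {x y} → x % n ≡ y % n → x ≈ y
  %≡⇒≈ {x} {y} e = ≈-trans (≈-sym (%-≈ x)) (≈-trans (≈-reflexive e) (%-≈ y))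

  ≈⇒≡ : ∀ {x y} → x < n → y < n → x ≈ y → x ≡ y
  ≈⇒≡ x<n y<n e = trans (sym (m<n⇒m%n≡m x<n)) (trans (≈⇒%≡ e) (m<n⇒m%n≡m y<n))

  n≈0 : n ≈ 0
  n≈0 = subst (_≈ 0) (*-identityʳ n) (n*≈0 1)

  toℕ-mod : ∀ t → toℕ (t mod n) ≈ t
  toℕ-mod t = ≈-trans (≈-reflexive (toℕ-fromℕ< _)) (%-≈ t)

  toℕ-injective-≈ : ∀ {i j : Fin n} → toℕ i ≈ toℕ j → i ≡ j
  toℕ-injective-≈ {i} {j} e = toℕ-injective (≈⇒≡ (toℕ<n i) (toℕ<n j) e)

  IsSucc⇒≈ : ∀ {i j : Fin n} → IsSucc i j → suc (toℕ i) ≈ toℕ j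
  IsSucc⇒≈ (inj₁ e)        = ≈-reflexive e
  IsSucc⇒≈ (inj₂ (e , e′)) = ≈-trans (≈-reflexive e) (≈-trans n≈0 (≈-reflexive (sym e′)))

  ≈⇒IsSucc : ∀ {i j : Fin n} → suc (toℕ i) ≈ toℕ j → IsSucc i j
  ≈⇒IsSucc {i} {j} e with m≤n⇒m<n∨m≡n (toℕ<n i)
  ... | inj₁ si<n = inj₁ (≈⇒≡ si<n (toℕ<n j) e)
  ... | inj₂ si≡n = inj₂ (si≡n , ≈⇒≡ (toℕ<n j) (≤-<-trans z≤n (toℕ<n i))
                      (≈-trans (≈-sym e) (≈-trans (≈-reflexive si≡n) n≈0)))

  2≉0 : 3 ≤ n → 2 ≉ 0
  2≉0 3≤n e with () ← ≈⇒≡ 3≤n (≤-trans (s≤s z≤n) 3≤n) e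

  4≉0 : 3 ≤ n → n ≢ 4 → 4 ≉ 0
  4≉0 3≤n n≢4 e with <-cmp n 4
  ... | tri> _ _ 4<n  with () ← ≈⇒≡ 4<n (≤-trans (s≤s z≤n) 4<n) e
  4≉0 3≤n n≢4 e | tri≈ _ n≡4 _ = n≢4 n≡4
  -- Only `n = 3` is left, where 4 has remainder 1.
  4≉0 3≤n n≢4 e | tri< n<4 _ _ with refl ← ≤-antisym 3≤n (≤-pred n<4) with () ← ≈⇒%≡ e

  shift≈⇒≈0 : ∀ d {t} → d + t ≈ t → d ≈ 0
  shift≈⇒≈0 d {t} e = +-cancelˡ-≈ t (subst₂ _≈_ (+-comm d t) (sym (+-identityʳ t)) e)

-- Exclusive or, and composition of automorphisms

xor-cancelˡ : ∀ x y → x xor (x xor y) ≡ y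
xor-cancelˡ false y     = refl
xor-cancelˡ true  false = refl
xor-cancelˡ true  true  = refl

xor-cancelʳ : ∀ x y → (x xor y) xor y ≡ x
xor-cancelʳ false false = refl
xor-cancelʳ false true  = refl
xor-cancelʳ true  false = refl
xor-cancelʳ true  true  = refl

infixr 9 _∘ₐ_
_∘ₐ_ : ∀ {n k} → Automorphism n k → Automorphism n k → Automorphism n k
ψ ∘ₐ φ = record
  { perm     = perm ψ ↔-∘ perm φ
  ; preserve = λ u v → preserve ψ _ _ ⇔-∘ preserve φ u v
  }
  where open Automorphism

-- Vertices, windows and walks

module PX (n m : ℕ) {{_ : NonZero n}} where

  open Cyclic n

  k : ℕ
  k = suc m

  V : Set
  V = Vertex n k

  idx : V → ℕ
  idx v = toℕ (proj₁ v)

  bits : V → ℕ → Bool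
  bits v = bit (proj₂ v)

  vertex : ℕ → (ℕ → Bool) → V
  vertex t f = t mod n , fromBits k f

  V-ext : ∀ {u v : V} → idx u ≈ idx v → (∀ p → p < k → bits u p ≡ bits v p) → u ≡ v
  V-ext e h = cong₂ _,_ (toℕ-injective-≈ e) (bit-ext h)

  Arc-idx : ∀ {u v : V} → Arc u v → suc (idx u) ≈ idx v
  Arc-idx (s , _) = IsSucc⇒≈ s

  Arc-bits : ∀ {u v : V} → Arc u v → ∀ p → p < m → bits u (suc p) ≡ bits v p
  Arc-bits (_ , s) p p<m = Shift⇒bits s p (s<s p<m)

  mkArc : ∀ {u v : V} → suc (idx u) ≈ idx v → (∀ p → p < m → bits u (suc p) ≡ bits v p) → Arc u v
  mkArc e h = ≈⇒IsSucc e , bits⇒Shift λ { p (s≤s p<m) → h p p<m }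

  -- The walk reading its bits off β: its t-th vertex has the window t, …, t + k - 1.
  walk : (ℕ → Bool) → ℕ → V
  walk β t = vertex t λ p → β (t + p)

  walk-bits : ∀ β t {p} → p < k → bits (walk β t) p ≡ β (t + p)
  walk-bits β t = bit-fromBits λ p → β (t + p)

  walk-Arc : ∀ β t → Arc (walk β t) (walk β (suc t))
  walk-Arc β t = mkArc
    (≈-trans (suc-cong-≈ (toℕ-mod t)) (≈-sym (toℕ-mod (suc t))))
    λ p p<m → begin
      bits (walk β t) (suc p)   ≡⟨ walk-bits β t (s<s p<m) ⟩
      β (t + suc p)             ≡⟨ cong β (+-suc t p) ⟩
      β (suc t + p)             ≡⟨ walk-bits β (suc t) (m<n⇒m<1+n p<m) ⟨
      bits (walk β (suc t)) p   ∎
    where open ≡-Reasoning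

  walk-cong : ∀ β γ {s t} → s ≈ t → (∀ p → p < k → β (s + p) ≡ γ (t + p)) → walk β s ≡ walk γ t
  walk-cong β γ {s} {t} e h = V-ext
    (≈-trans (toℕ-mod s) (≈-trans e (≈-sym (toℕ-mod t))))
    λ p p<k → trans (walk-bits β s p<k) (trans (h p p<k) (sym (walk-bits γ t p<k)))

  zeros : ℕ → Bool
  zeros _ = false

  O : ℕ → V
  O = walk zeros

  O-bits : ∀ t {p} → p < k → bits (O t) p ≡ false
  O-bits = walk-bits zeros

  O-cong : ∀ {s t} → s ≈ t → O s ≡ O t
  O-cong e = walk-cong zeros zeros e λ _ _ → refl

  VanishesBelow : ℕ → (ℕ → Bool) → Set
  VanishesBelow b β = ∀ q → q < b → β q ≡ false

  -- Places a prescribed bit sequence at position `b` of a walk whose earlier bits are all zero.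
  delay : ℕ → (ℕ → Bool) → ℕ → Bool
  delay zero    f q       = f q
  delay (suc b) f zero    = false
  delay (suc b) f (suc q) = delay b f q

  delay-vanishes : ∀ b f → VanishesBelow b (delay b f)
  delay-vanishes (suc b) f zero    _         = refl
  delay-vanishes (suc b) f (suc q) (s≤s q<b) = delay-vanishes b f q q<b

  delay-+ : ∀ b f p → delay b f (b + p) ≡ f p
  delay-+ zero    f p = refl
  delay-+ (suc b) f p = delay-+ b f p

  walk-start : ∀ β → VanishesBelow k β → walk β 0 ≡ O 0
  walk-start β h = walk-cong β zeros ≈-refl h

  -- The shift by n makes walk (code v) start at the zero vertex O 0, since k ≤ n.
  code : V → ℕ → Bool
  code v = delay (n + idx v) (bits v)

  code-walk : ∀ v → walk (code v) (n + idx v) ≡ v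
  code-walk v = V-ext
    (≈-trans (toℕ-mod (n + idx v)) (+-cong-≈ n≈0 ≈-refl))
    λ p p<k → trans (walk-bits (code v) (n + idx v) p<k) (delay-+ (n + idx v) (bits v) p)

  -- Arc-preserving injections that fix a covering family of zero vertices

  -- Every bit of f v is transported along walks to the last bit of the image of a vertex whose
  -- other bits vanish, and such a vertex is fixed.
  module Directed
    (f : V → V) (f-inj : ∀ {u v} → f u ≡ f v → u ≡ v)
    (f-Arc : ∀ {u v} → Arc u v → Arc (f u) (f v))
    (cover : ∀ t → ∃ λ j → ∃ λ q → q < k × j + q ≈ t × f (O j) ≡ O j)
    where

    open ≡-Reasoning

    -- The image of a walk is again a walk, so each arc moves a bit one position towards the head.
    f-walk-shift : ∀ β t p {q} → p + q < k → bits (f (walk β t)) (p + q) ≡ bits (f (walk β (p + t))) q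
    f-walk-shift β t zero    _                 = refl
    f-walk-shift β t (suc p) {q} (s≤s p+q<m) = begin
      bits (f (walk β t)) (suc p + q)     ≡⟨ Arc-bits (f-Arc (walk-Arc β t)) (p + q) p+q<m ⟩
      bits (f (walk β (suc t))) (p + q)   ≡⟨ f-walk-shift β (suc t) p (m<n⇒m<1+n p+q<m) ⟩
      bits (f (walk β (p + suc t))) q     ≡⟨ cong (λ s → bits (f (walk β s)) q) (+-suc p t) ⟩
      bits (f (walk β (suc p + t))) q     ∎

    f-walk-head : ∀ β t {p} → p < k → bits (f (walk β t)) p ≡ bits (f (walk β (p + t))) 0
    f-walk-head β t {p} p<k = begin
      bits (f (walk β t)) p         ≡⟨ cong (bits (f (walk β t))) (+-identityʳ p) ⟨
      bits (f (walk β t)) (p + 0)   ≡⟨ f-walk-shift β t p (subst (_< k) (sym (+-identityʳ p)) p<k) ⟩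
      bits (f (walk β (p + t))) 0   ∎

    f-walk-idx : ∀ β t s → idx (f (walk β (t + s))) ≈ t + idx (f (walk β s))
    f-walk-idx β zero    s = ≈-refl
    f-walk-idx β (suc t) s =
      ≈-trans (≈-sym (Arc-idx (f-Arc (walk-Arc β (t + s))))) (suc-cong-≈ (f-walk-idx β t s))

    -- Along a walk the index grows by one before and after `f`, so the fixed `O j` determines where
    -- `O 0` goes.
    f-O0-idx : idx (f (O 0)) ≈ 0
    f-O0-idx with cover 0
    ... | j , _ , _ , _ , fixed = +-cancelˡ-≈ j
      (≈-trans (≈-sym (f-walk-idx zeros j 0)) (≈-trans (≈-reflexive eq) (toℕ-mod (j + 0))))
      where
      eq : idx (f (O (j + 0))) ≡ idx (O (j + 0))
      eq = cong idx (subst (λ s → f (O s) ≡ O s) (sym (+-identityʳ j)) fixed)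

    f-idx : ∀ β → VanishesBelow k β → ∀ t → idx (f (walk β t)) ≈ t
    f-idx β h t = ≈-trans (≈-reflexive (cong (idx ∘ f ∘ walk β) (sym (+-identityʳ t))))
      (≈-trans (f-walk-idx β t 0)
      (≈-trans (+-cong-≈ (≈-refl {t}) (subst (λ v → idx (f v) ≈ 0) (sym (walk-start β h)) f-O0-idx))
        (≈-reflexive (+-identityʳ t))))

    -- The bit at position `p + t` also lies in the window of some fixed `O j`, where it is known to
    -- be zero.
    f-O : ∀ t → f (O t) ≡ O t
    f-O t = V-ext (≈-trans (f-idx zeros (λ _ _ → refl) t) (≈-sym (toℕ-mod t))) eq
      where
      eq : ∀ p → p < k → bits (f (O t)) p ≡ bits (O t) p
      eq p p<k with cover (p + t)
      ... | j , q , q<k , j+q≈p+t , fixed = begin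
        bits (f (O t)) p         ≡⟨ f-walk-head zeros t p<k ⟩
        bits (f (O (p + t))) 0   ≡⟨ cong (λ v → bits (f v) 0)
                                      (O-cong (≈-trans (≈-sym j+q≈p+t) (≈-reflexive (+-comm j q)))) ⟩
        bits (f (O (q + j))) 0   ≡⟨ f-walk-head zeros j q<k ⟨
        bits (f (O j)) q         ≡⟨ cong (λ v → bits v q) fixed ⟩
        bits (O j) q             ≡⟨ O-bits j q<k ⟩
        false                    ≡⟨ O-bits t p<k ⟨
        bits (O t) p             ∎

    -- The image is an out-neighbour of the fixed vertex `O t`, so only its last bit is open. A
    -- wrong last bit would make two vertices share the image `O (suc t)`.
    f-last : ∀ β t → (∀ q → q < m → β (suc t + q) ≡ false) →
             bits (f (walk β (suc t))) m ≡ β (suc t + m)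
    f-last β t h with β (suc t + m) in last
    ... | false = trans (cong (λ v → bits v m) (trans (cong f to-O) (f-O (suc t)))) (O-bits (suc t) ≤-refl)
      where
      to-O : walk β (suc t) ≡ O (suc t)
      to-O = walk-cong β zeros ≈-refl λ p p<k → case-last p (m≤n⇒m<n∨m≡n (≤-pred p<k))
        where
        case-last : ∀ p → p < m ⊎ p ≡ m → β (suc t + p) ≡ false
        case-last p (inj₁ p<m)  = h p p<m
        case-last p (inj₂ refl) = last
    ... | true with bits (f (walk β (suc t))) m in image
    ...   | true  = refl
    -- The goal here is `false ≡ true`; `to-O`, obtained from injectivity, supplies it.
    ...   | false = trans (sym (O-bits (suc t) ≤-refl))
                      (trans (cong (λ v → bits v m) (sym to-O)) (trans (walk-bits β (suc t) ≤-refl) last))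
      where
      arc : Arc (O t) (walk β (suc t))
      arc = mkArc (≈-trans (suc-cong-≈ (toℕ-mod t)) (≈-sym (toℕ-mod (suc t)))) λ p p<m →
        trans (O-bits t (s<s p<m)) (sym (trans (walk-bits β (suc t) (m<n⇒m<1+n p<m)) (h p p<m)))
      f-arc : Arc (O t) (f (walk β (suc t)))
      f-arc = subst (λ v → Arc v (f (walk β (suc t)))) (f-O t) (f-Arc arc)
      f-bits : ∀ p → p < m ⊎ p ≡ m → bits (f (walk β (suc t))) p ≡ false
      f-bits p (inj₁ p<m)  = trans (sym (Arc-bits f-arc p p<m)) (O-bits t (s<s p<m))
      f-bits p (inj₂ refl) = image
      to-O : walk β (suc t) ≡ O (suc t)
      to-O = f-inj (trans (V-ext
        (≈-trans (≈-sym (Arc-idx f-arc)) (≈-trans (suc-cong-≈ (toℕ-mod t)) (≈-sym (toℕ-mod (suc t)))))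
        λ p p<k → trans (f-bits p (m≤n⇒m<n∨m≡n (≤-pred p<k))) (sym (O-bits (suc t) p<k)))
        (sym (f-O (suc t))))

    -- The head bit of a walk vertex depends on that vertex alone. Replacing the earlier bits by
    -- zeros (`γ`) turns the bit into the last one of a vertex that is otherwise zero, where
    -- `f-last` applies.
    f-head : ∀ β t → bits (f (walk β (m + suc t))) 0 ≡ β (m + suc t)
    f-head β t = begin
      bits (f (walk β (m + suc t))) 0   ≡⟨ cong (λ v → bits (f v) 0) (walk-cong β γ ≈-refl agree) ⟩
      bits (f (walk γ (m + suc t))) 0   ≡⟨ f-walk-head γ (suc t) ≤-refl ⟨
      bits (f (walk γ (suc t))) m       ≡⟨ f-last γ t vanish ⟩
      γ (suc t + m)                     ≡⟨ cong γ (+-comm (suc t) m) ⟩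
      γ (m + suc t)                     ≡⟨ cong γ (+-identityʳ _) ⟨
      γ (m + suc t + 0)                 ≡⟨ agree 0 z<s ⟨
      β (m + suc t + 0)                 ≡⟨ cong β (+-identityʳ _) ⟩
      β (m + suc t)                     ∎
      where
      γ : ℕ → Bool
      γ = delay (m + suc t) λ p → β (m + suc t + p)
      agree : ∀ p → p < k → β (m + suc t + p) ≡ γ (m + suc t + p)
      agree p _ = sym (delay-+ (m + suc t) _ p)
      vanish : ∀ q → q < m → γ (suc t + q) ≡ false
      vanish q q<m = delay-vanishes (m + suc t) _ (suc t + q)
        (subst (_< m + suc t) (+-comm q (suc t)) (+-monoˡ-< (suc t) q<m))

    f≗id : k ≤ n → ∀ v → f v ≡ v
    f≗id k≤n v = subst (λ u → f u ≡ u) (code-walk v) (V-ext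
      (≈-trans (f-idx β (λ q q<k → delay-vanishes t (bits v) q (<-≤-trans q<k (≤-trans k≤n (m≤m+n n _)))) t)
               (≈-sym (toℕ-mod t)))
      eq)
      where
      t d : ℕ
      t = n + idx v
      d = t ∸ k
      β : ℕ → Bool
      β = code v
      -- `f-head` concerns positions that are at least `k`; `t` is one because `k ≤ n ≤ t`.
      t≡ : m + suc d ≡ t
      t≡ = trans (+-suc m d) (m+[n∸m]≡n (≤-trans k≤n (m≤m+n n _)))
      eq : ∀ p → p < k → bits (f (walk β t)) p ≡ bits (walk β t) p
      eq p p<k = begin
        bits (f (walk β t)) p                 ≡⟨ f-walk-head β t p<k ⟩
        bits (f (walk β (p + t))) 0           ≡⟨ cong (λ s → bits (f (walk β s)) 0) p+t≡ ⟩
        bits (f (walk β (m + suc (p + d)))) 0 ≡⟨ f-head β (p + d) ⟩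
        β (m + suc (p + d))                   ≡⟨ cong β p+t≡ ⟨
        β (p + t)                             ≡⟨ cong β (+-comm p t) ⟩
        β (t + p)                             ≡⟨ walk-bits β t p<k ⟨
        bits (walk β t) p                     ∎
        where
        p+t≡ : p + t ≡ m + suc (p + d)
        p+t≡ = trans (cong (p +_) (sym t≡)) (shuffle p m d)
          where
          shuffle : ∀ p m d → p + (m + suc d) ≡ m + suc (p + d)
          shuffle = solve-∀

  -- Single bit flips and common neighbours

  xorBits : (ℕ → Bool) → V → V
  xorBits c v = proj₁ v , fromBits k λ p → c p xor bits v p

  xorBits-bits : ∀ c v {p} → p < k → bits (xorBits c v) p ≡ c p xor bits v p
  xorBits-bits c v = bit-fromBits λ p → c p xor bits v p

  δ : ℕ → ℕ → Bool
  δ q p = does (p ≟ q)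

  flipAt : ℕ → V → V
  flipAt q = xorBits (δ q)

  flipAt-other : ∀ q v {p} → p < k → p ≢ q → bits (flipAt q v) p ≡ bits v p
  flipAt-other q v {p} p<k p≢q =
    trans (xorBits-bits (δ q) v p<k) (cong (_xor bits v p) (dec-false (p ≟ q) p≢q))

  flipAt-≢ : ∀ {q} v → q < k → flipAt q v ≢ v
  flipAt-≢ {q} v q<k e = not-¬ refl (begin
    bits v q               ≡⟨ cong (λ u → bits u q) e ⟨
    bits (flipAt q v) q    ≡⟨ xorBits-bits (δ q) v q<k ⟩
    δ q q xor bits v q     ≡⟨ cong (_xor bits v q) (dec-true (q ≟ q) refl) ⟩
    not (bits v q)         ∎)
    where open ≡-Reasoning

  -- Free of arc directions, hence preserved and reflected by automorphisms.
  Twin : V → V → V → Set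
  Twin v a b = ∃ λ t → t ≢ v × Adj n k t a × Adj n k t b

  -- Out-neighbours do not see the first bit of `v`, so flipping it yields the second common
  -- neighbour.
  out-Twin : ∀ {v a b} → Arc v a → Arc v b → Twin v a b
  out-Twin {v} va vb = flipAt 0 v , flipAt-≢ v z<s , inj₁ (arc va) , inj₁ (arc vb)
    where
    arc : ∀ {w} → Arc v w → Arc (flipAt 0 v) w
    arc vw = mkArc (Arc-idx vw) λ p p<m → trans (flipAt-other 0 v (s<s p<m) λ ()) (Arc-bits vw p p<m)

  -- In-neighbours do not see the last bit of `v`.
  in-Twin : ∀ {v a b} → Arc a v → Arc b v → Twin v a b
  in-Twin {v} av bv = flipAt m v , flipAt-≢ v ≤-refl , inj₂ (arc av) , inj₂ (arc bv)
    where
    arc : ∀ {w} → Arc w v → Arc w (flipAt m v)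
    arc wv = mkArc (Arc-idx wv) λ p p<m →
      trans (Arc-bits wv p p<m) (sym (flipAt-other m v (m<n⇒m<1+n p<m) (<⇒≢ p<m)))

  straight-¬Twin : 3 ≤ n → n ≢ 4 → 1 ≤ m → ∀ {v a b} → Arc a v → Arc v b → ¬ Twin v a b
  straight-¬Twin 3≤n n≢4 (s≤s _) {v} {a} {b} av vb (t , t≢v , ta , tb) = go ta tb
    where
    a+2≈b : 2 + idx a ≈ idx b
    a+2≈b = ≈-trans (suc-cong-≈ (Arc-idx av)) (Arc-idx vb)
    go : Adj n k t a → Adj n k t b → ⊥
    go (inj₁ ta) (inj₁ tb) =
      2≉0 3≤n (shift≈⇒≈0 2 (≈-trans a+2≈b (≈-trans (≈-sym (Arc-idx tb)) (Arc-idx ta))))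
    -- `t`, `a`, `v`, `b` form a directed closed walk of length 4.
    go (inj₁ ta) (inj₂ bt) = 4≉0 3≤n n≢4 (shift≈⇒≈0 4
      (≈-trans (suc-cong-≈ (≈-trans (suc-cong-≈ (suc-cong-≈ (Arc-idx ta))) a+2≈b)) (Arc-idx bt)))
    -- `t` has the window of `v`: `a` determines all bits but the last, and `b` determines the last
    -- one because `m ≥ 1`.
    go (inj₂ at) (inj₁ tb) = t≢v (V-ext (≈-trans (≈-sym (Arc-idx at)) (Arc-idx av)) λ p p<k →
      eq p (m≤n⇒m<n∨m≡n (≤-pred p<k)))
      where
      eq : ∀ p → p < m ⊎ p ≡ m → bits t p ≡ bits v p
      eq p (inj₁ p<m)  = trans (sym (Arc-bits at p p<m)) (Arc-bits av p p<m)
      eq p (inj₂ refl) = trans (Arc-bits tb _ ≤-refl) (sym (Arc-bits vb _ ≤-refl))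
    go (inj₂ at) (inj₂ bt) = 2≉0 3≤n (shift≈⇒≈0 2
      (≈-trans a+2≈b (suc-injective-≈ (≈-trans (Arc-idx bt) (≈-sym (Arc-idx at))))))

  -- Automorphisms preserve or reverse all arcs

  module Action (φ : Automorphism n k) where

    open Automorphism φ
    open Inverse perm using (to; from; strictlyInverseˡ; strictlyInverseʳ)

    f : V → V
    f = to

    f-injective : ∀ {u v} → f u ≡ f v → u ≡ v
    f-injective {u} {v} e = trans (sym (strictlyInverseʳ u)) (trans (cong from e) (strictlyInverseʳ v))

    f-Adj : ∀ {u v} → Adj n k u v → Adj n k (f u) (f v)
    f-Adj {u} {v} = Equivalence.to (preserve u v)

    f-Adj⁻ : ∀ {u v} → Adj n k (f u) (f v) → Adj n k u v
    f-Adj⁻ {u} {v} = Equivalence.from (preserve u v)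

    Twin-reflect : ∀ {v a b} → Twin (f v) (f a) (f b) → Twin v a b
    Twin-reflect {v} (t , t≢fv , ta , tb) = from t , t′≢v , pull ta , pull tb
      where
      t′≢v : from t ≢ v
      t′≢v e = t≢fv (trans (sym (strictlyInverseˡ t)) (cong f e))
      pull : ∀ {w} → Adj n k t (f w) → Adj n k (from t) w
      pull tw = f-Adj⁻ (subst (λ u → Adj n k u _) (sym (strictlyInverseˡ t)) tw)

    Twin-preserve : ∀ {v a b} → Twin v a b → Twin (f v) (f a) (f b)
    Twin-preserve (t , t≢v , ta , tb) = f t , t≢v ∘ f-injective , f-Adj ta , f-Adj tb

    module _ (3≤n : 3 ≤ n) (n≢4 : n ≢ 4) (1≤m : 1 ≤ m) where

      ¬Twin : ∀ {v a b} → Arc a v → Arc v b → ¬ Twin v a b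
      ¬Twin = straight-¬Twin 3≤n n≢4 1≤m

      Forward Backward : V → Set
      Forward  v = ∀ {w} → Arc v w → Arc (f v) (f w)
      Backward v = ∀ {w} → Arc v w → Arc (f w) (f v)

      start-Forward : ∀ {v w} → Arc v w → Arc (f v) (f w) → Forward v
      start-Forward vw fvw vx with f-Adj (inj₁ vx)
      ... | inj₁ fvx = fvx
      ... | inj₂ fxv = ⊥-elim (¬Twin fxv fvw (Twin-preserve (out-Twin vx vw)))

      start-Backward : ∀ {v w} → Arc v w → Arc (f w) (f v) → Backward v
      start-Backward vw fwv vx with f-Adj (inj₁ vx)
      ... | inj₁ fvx = ⊥-elim (¬Twin fwv fvx (Twin-preserve (out-Twin vw vx)))
      ... | inj₂ fxv = fxv

      -- If `f x` preceded `f w`, then `f v` and `f x` would both be in-neighbours of `f w`, hence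
      -- twins, while `v` and `x` lie on opposite sides of `w`.
      Forward-step : ∀ {v w} → Arc v w → Forward v → Forward w
      Forward-step vw fwd wx with f-Adj (inj₁ wx)
      ... | inj₁ fwx = fwx
      ... | inj₂ fxw = ⊥-elim (¬Twin vw wx (Twin-reflect (in-Twin (fwd vw) fxw)))

      Backward-step : ∀ {v w} → Arc v w → Backward v → Backward w
      Backward-step vw bwd wx with f-Adj (inj₁ wx)
      ... | inj₁ fwx = ⊥-elim (¬Twin vw wx (Twin-reflect (out-Twin (bwd vw) fwx)))
      ... | inj₂ fxw = fxw

      Forward-walk : ∀ β → Forward (walk β 0) → ∀ t → Forward (walk β t)
      Forward-walk β fwd zero    = fwd
      Forward-walk β fwd (suc t) = Forward-step (walk-Arc β t) (Forward-walk β fwd t)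

      Backward-walk : ∀ β → Backward (walk β 0) → ∀ t → Backward (walk β t)
      Backward-walk β bwd zero    = bwd
      Backward-walk β bwd (suc t) = Backward-step (walk-Arc β t) (Backward-walk β bwd t)

      -- Each reversed arc lowers the index by one.
      Backward-idx : Backward (O 0) → ∀ t → t + idx (f (O t)) ≈ idx (f (O 0))
      Backward-idx bwd zero    = ≈-refl
      Backward-idx bwd (suc t) = ≈-trans (≈-reflexive (sym (+-suc t _)))
        (≈-trans (+-cong-≈ (≈-refl {t}) (Arc-idx (Backward-walk zeros bwd t (walk-Arc zeros t))))
                 (Backward-idx bwd t))

      module _ (k≤n : k ≤ n) (f-O0 : f (O 0) ≡ O 0)
               (j : ℕ) (j+j≉0 : j + j ≉ 0) (f-Oj : f (O j) ≡ O j)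
               (cover : ∀ t → ∃ λ j → ∃ λ q → q < k × j + q ≈ t × f (O j) ≡ O j) where

        -- A reversal fixing `O 0` takes index `j` to its negative, so fixing `O j` would force
        -- `j + j ≈ 0`.
        ¬Backward-O0 : ¬ Backward (O 0)
        ¬Backward-O0 bwd = j+j≉0 (≈-trans (+-cong-≈ (≈-refl {j}) j≈) (≈-trans (Backward-idx bwd j) 0≈))
          where
          j≈ : j ≈ idx (f (O j))
          j≈ = ≈-sym (≈-trans (≈-reflexive (cong idx f-Oj)) (toℕ-mod j))
          0≈ : idx (f (O 0)) ≈ 0
          0≈ = ≈-trans (≈-reflexive (cong idx f-O0)) (toℕ-mod 0)

        Forward-O0 : Forward (O 0)
        Forward-O0 =
          [ (λ fwd → start-Forward {O 0} {O 1} first fwd)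
          , (λ bwd → ⊥-elim (¬Backward-O0 λ {x} → start-Backward {O 0} {O 1} first bwd)) ]′ (f-Adj (inj₁ first))
          where
          first : Arc (O 0) (O 1)
          first = walk-Arc zeros 0

        -- Every vertex is reached by a walk from `O 0`, along which the direction propagates.
        Forward-all : ∀ v → Forward v
        Forward-all v = subst Forward (code-walk v) (Forward-walk (code v)
          (subst Forward (sym (walk-start (code v) vanish)) Forward-O0) (n + idx v))
          where
          vanish : VanishesBelow k (code v)
          vanish q q<k = delay-vanishes (n + idx v) (bits v) q
            (<-≤-trans q<k (≤-trans k≤n (m≤m+n n _)))

        fixes-all : ∀ v → f v ≡ v
        fixes-all = Directed.f≗id f f-injective (λ {u} uv → Forward-all u uv) cover k≤n

  -- Automorphisms flipping bits

  involution⇒Automorphism : (g : V → V) → (∀ v → g (g v) ≡ v) →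
    (∀ {u v} → Adj n k u v → Adj n k (g u) (g v)) → Automorphism n k
  involution⇒Automorphism g g∘g g-Adj = record
    { perm     = mk↔ₛ′ g g g∘g g∘g
    ; preserve = λ u v → mk⇔ g-Adj λ h → subst₂ (Adj n k) (g∘g u) (g∘g v) (g-Adj h)
    }

  -- Reducing modulo `n` makes `c` a function on the cyclic positions, so overlapping windows see
  -- the same flips.
  mask : (ℕ → Bool) → V → ℕ → Bool
  mask c v p = c ((idx v + p) % n)

  translateV : (ℕ → Bool) → V → V
  translateV c v = xorBits (mask c v) v

  translateV-bits : ∀ c v {p} → p < k → bits (translateV c v) p ≡ mask c v p xor bits v p
  translateV-bits c v = xorBits-bits (mask c v) v

  translate : (ℕ → Bool) → Automorphism n k
  translate c = involution⇒Automorphism (translateV c) involutive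
    λ { (inj₁ uv) → inj₁ (arc uv) ; (inj₂ vu) → inj₂ (arc vu) }
    where
    involutive : ∀ v → translateV c (translateV c v) ≡ v
    involutive v = V-ext ≈-refl λ p p<k → trans (translateV-bits c (translateV c v) p<k)
      (trans (cong (mask c v p xor_) (translateV-bits c v p<k)) (xor-cancelˡ (mask c v p) (bits v p)))
    arc : ∀ {u v} → Arc u v → Arc (translateV c u) (translateV c v)
    arc {u} {v} uv = mkArc (Arc-idx uv) λ p p<m →
      trans (translateV-bits c u (s<s p<m))
      (trans (cong₂ _xor_ (cong c (≈⇒%≡ (shift p))) (Arc-bits uv p p<m))
             (sym (translateV-bits c v (m<n⇒m<1+n p<m))))
      where
      shift : ∀ p → idx u + suc p ≈ idx v + p
      shift p = ≈-trans (≈-reflexive (+-suc (idx u) p)) (+-cong-≈ (Arc-idx uv) ≈-refl)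

  -- Lower bound by covering

  -- Quantified over finite types so that `any?` decides it.
  Covers : List V → ℕ → Set
  Covers S r = ∃ λ (a : Fin (length S)) → ∃ λ (p : Fin k) → (idx (lookup S a) + toℕ p) % n ≡ r % n

  -- If no window contains `r`, flipping the bit there fixes all of `S` but moves `O r`.
  determining⇒covers : ∀ {S} → IsDeterminingSet n k S → ∀ r → Covers S r
  determining⇒covers {S} det r
    with any? (λ a → any? λ p → (idx (lookup S a) + toℕ p) % n ≟ r % n)
  ... | yes covers  = covers
  ... | no ¬covers = ⊥-elim (not-¬ refl (begin
      false                            ≡⟨ O-bits r z<s ⟨
      bits (O r) 0                     ≡⟨ cong (λ v → bits v 0) (det (translate c) fixes (O r)) ⟨
      bits (translateV c (O r)) 0      ≡⟨ translateV-bits c (O r) z<s ⟩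
      mask c (O r) 0 xor bits (O r) 0  ≡⟨ cong₂ _xor_ (dec-true (_ ≟ _) at-r) (O-bits r z<s) ⟩
      true                             ∎))
    where
    open ≡-Reasoning
    c : ℕ → Bool
    c = δ (r % n)
    at-r : (idx (O r) + 0) % n ≡ r % n
    at-r = trans (cong (_% n) (+-identityʳ (idx (O r)))) (≈⇒%≡ (toℕ-mod r))
    fixes : ∀ v → v ∈ S → translateV c v ≡ v
    fixes v v∈S = V-ext ≈-refl λ p p<k → trans (translateV-bits c v p<k)
      (cong (_xor bits v p) (dec-false (_ ≟ _) λ e → ¬covers
        (index v∈S , fromℕ< p<k , trans (cong (_% n)
          (cong₂ _+_ (cong idx (sym (lookup-index v∈S))) (toℕ-fromℕ< p<k))) e)))

  -- A position is recovered from a member of `S` and an offset in its window, and there are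
  -- `length S * k` such pairs.
  determining⇒n≤ : ∀ {S} → IsDeterminingSet n k S → n ≤ length S * k
  determining⇒n≤ {S} det = injective⇒≤ {f = address} λ {r} {r′} → address-injective r r′
    where
    address : Fin n → Fin (length S * k)
    address r with determining⇒covers det (toℕ r)
    ... | a , p , _ = combine a p
    address-injective : ∀ r r′ → address r ≡ address r′ → r ≡ r′
    address-injective r r′ e
      with determining⇒covers det (toℕ r) | determining⇒covers det (toℕ r′)
    ... | a , p , h | a′ , p′ , h′ with refl , refl ← combine-injective a p a′ p′ e =
      toℕ-injective-≈ (%≡⇒≈ (trans (sym h) h′))

  ceilDiv-≤ : ∀ {d} → n ≤ d * k → ceilDiv n k ≤ d
  ceilDiv-≤ {d} n≤d*k = ≤-pred (m<n*o⇒m/o<n {n + m} {suc d} (begin-strict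
    n + m       ≡⟨ +-comm n m ⟩
    m + n       <⟨ +-mono-<-≤ (n<1+n m) n≤d*k ⟩
    k + d * k   ∎))
    where open ≤-Reasoning

  -- Reflections and the case n = 2k

  -- The window starting at `i` goes to the one starting at `c - i`, read backwards; `n ∸ idx v`
  -- represents the negative of the index.
  reflectV : ℕ → V → V
  reflectV c v = (c + (n ∸ idx v)) mod n , fromBits k λ p → bits v (m ∸ p)

  reflectV-idx : ∀ c v → idx (reflectV c v) + idx v ≈ c
  reflectV-idx c v = ≈-trans (+-cong-≈ (toℕ-mod (c + (n ∸ idx v))) (≈-refl {idx v}))
    (≈-trans (≈-reflexive (trans (+-assoc c _ _) (cong (c +_) (m∸n+n≡m (<⇒≤ (toℕ<n (proj₁ v)))))))
    (≈-trans (+-cong-≈ (≈-refl {c}) n≈0) (≈-reflexive (+-identityʳ c))))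

  reflectV-bits : ∀ c v {p} → p < k → bits (reflectV c v) p ≡ bits v (m ∸ p)
  reflectV-bits c v = bit-fromBits λ p → bits v (m ∸ p)

  reflect : ℕ → Automorphism n k
  reflect c = involution⇒Automorphism (reflectV c) involutive
    λ { (inj₁ uv) → inj₂ (arc uv) ; (inj₂ vu) → inj₁ (arc vu) }
    where
    involutive : ∀ v → reflectV c (reflectV c v) ≡ v
    involutive v = V-ext
      (+-cancelʳ-≈ (idx (reflectV c v)) (≈-trans (reflectV-idx c (reflectV c v))
        (≈-trans (≈-sym (reflectV-idx c v)) (≈-reflexive (+-comm (idx (reflectV c v)) (idx v))))))
      λ p p<k → trans (reflectV-bits c (reflectV c v) p<k)
        (trans (reflectV-bits c v (s≤s (m∸n≤m m p))) (cong (bits v) (m∸[m∸n]≡n (≤-pred p<k))))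
    arc : ∀ {u v} → Arc u v → Arc (reflectV c v) (reflectV c u)
    arc {u} {v} uv = mkArc
      (+-cancelʳ-≈ (idx u) (≈-trans (≈-reflexive (sym (+-suc (idx (reflectV c v)) (idx u))))
        (≈-trans (+-cong-≈ (≈-refl {idx (reflectV c v)}) (Arc-idx uv))
        (≈-trans (reflectV-idx c v) (≈-sym (reflectV-idx c u))))))
      λ p p<m → begin
        bits (reflectV c v) (suc p)     ≡⟨ reflectV-bits c v (s<s p<m) ⟩
        bits v (m ∸ suc p)              ≡⟨ Arc-bits uv (m ∸ suc p) (∸-monoʳ-< z<s p<m) ⟨
        bits u (suc (m ∸ suc p))        ≡⟨ cong (bits u) (+-∸-assoc 1 p<m) ⟨
        bits u (m ∸ p)                  ≡⟨ reflectV-bits c u (m<n⇒m<1+n p<m) ⟨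
        bits (reflectV c u) p           ∎
      where open ≡-Reasoning

  -- The positions `idx s + k` and `idx s + (k + m)` lie outside the window of `s`, hence in that of
  -- `t`. They are `m` apart, so they are its two ends.
  antipodal : ∀ {s t} → n ≡ k + k → IsDeterminingSet n k (s ∷ t ∷ []) → idx t ≈ idx s + k
  antipodal {s} {t} n≡k+k det
    with determining⇒covers det (idx s + k) | determining⇒covers det (idx s + (k + m))
  ... | zero , p , e | _ = ⊥-elim (<⇒≢ (toℕ<n p)
    (≈⇒≡ (<-≤-trans (toℕ<n p) k≤n) k<n (+-cancelˡ-≈ (idx s) (%≡⇒≈ e))))
    where
    k≤n : k ≤ n
    k≤n = subst (k ≤_) (sym n≡k+k) (m≤m+n k k)
    k<n : k < n
    k<n = subst (k <_) (sym n≡k+k) (m<m+n k z<s)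
  ... | suc zero , _ | zero , q , e = ⊥-elim (<⇒≢ (<-≤-trans (toℕ<n q) (m≤m+n k m))
    (≈⇒≡ (<-≤-trans (toℕ<n q) k≤n) k+m<n (+-cancelˡ-≈ (idx s) (%≡⇒≈ e))))
    where
    k≤n : k ≤ n
    k≤n = subst (k ≤_) (sym n≡k+k) (m≤m+n k k)
    k+m<n : k + m < n
    k+m<n = subst (k + m <_) (sym n≡k+k) (+-monoʳ-< k (n<1+n m))
  ... | suc zero , p , e | suc zero , q , e′ = ≈-trans
    (≈-reflexive (trans (sym (+-identityʳ (idx t))) (cong (idx t +_) (sym p≡0)))) (%≡⇒≈ e)
    where
    q≈p+m : toℕ q ≈ toℕ p + m
    q≈p+m = +-cancelˡ-≈ (idx t) (≈-trans (%≡⇒≈ e′)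
      (≈-trans (≈-reflexive (sym (+-assoc (idx s) k m)))
      (≈-trans (+-cong-≈ (≈-sym (%≡⇒≈ e)) (≈-refl {m})) (≈-reflexive (+-assoc (idx t) _ m)))))
    q≡p+m : toℕ q ≡ toℕ p + m
    q≡p+m = ≈⇒≡ (<-≤-trans (toℕ<n q) (subst (k ≤_) (sym n≡k+k) (m≤m+n k k)))
      (subst (toℕ p + m <_) (sym n≡k+k) (+-mono-<-≤ (toℕ<n p) (n≤1+n m))) q≈p+m
    p≡0 : toℕ p ≡ 0
    p≡0 = n≤0⇒n≡0 (+-cancelʳ-≤ m (toℕ p) 0 (subst (_≤ m) q≡p+m (≤-pred (toℕ<n q))))

  pair-¬determining : ∀ {s t} → 3 ≤ n → n ≡ k + k → ¬ IsDeterminingSet n k (s ∷ t ∷ [])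
  pair-¬determining {s} {t} 3≤n n≡k+k det = 2≉0 3≤n (shift≈⇒≈0 2 (≈-trans
    (≈-reflexive (shuffle (idx s))) (≈-trans (≈-sym (+-cong-≈ idx-moved idx-moved)) fixed-idx)))
    where
    open ≡-Reasoning
    shuffle : ∀ i → 2 + (i + i) ≡ suc i + suc i
    shuffle = solve-∀
    -- This reflection fixes the index of `s`, and that of `t` too since `k + k ≈ 0`.
    axis : ℕ
    axis = idx s + idx s
    asymmetry : V → ℕ → Bool
    asymmetry v p = bits v p xor bits v (m ∸ p)
    -- `d` is the offset of `r` from `idx s`. The first `k` offsets form the window of `s` and the
    -- others that of `t`, so both corrections can be prescribed independently.
    c : ℕ → Bool
    c r = let d = (r + (n ∸ idx s)) % n in
      if does (d <? k) then asymmetry s d else asymmetry t (d ∸ k)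
    ψ : Automorphism n k
    ψ = translate c ∘ₐ reflect axis
    offset : ∀ {x d} → x ≈ idx s + d → d < n → (x % n + (n ∸ idx s)) % n ≡ d
    offset {x} {d} e d<n = trans (≈⇒%≡ (≈-trans (+-cong-≈ (≈-trans (%-≈ x) e) (≈-refl {n ∸ idx s}))
      (≈-trans (≈-reflexive (trans (swap-last (idx s) d _)
        (cong (d +_) (m+[n∸m]≡n (<⇒≤ (toℕ<n (proj₁ s)))))))
      (≈-trans (+-cong-≈ (≈-refl {d}) n≈0) (≈-reflexive (+-identityʳ d))))))
      (m<n⇒m%n≡m d<n)
      where
      swap-last : ∀ a b c → a + b + c ≡ b + (a + c)
      swap-last = solve-∀
    fixes-if : ∀ v → idx v + idx v ≈ axis →
      (∀ p → p < k → c ((idx v + p) % n) ≡ asymmetry v p) → translateV c (reflectV axis v) ≡ v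
    fixes-if v v+v≈axis h = V-ext idx≈ λ p p<k → begin
      bits (translateV c (reflectV axis v)) p                     ≡⟨ translateV-bits c (reflectV axis v) p<k ⟩
      mask c (reflectV axis v) p xor bits (reflectV axis v) p     ≡⟨ cong₂ _xor_
        (trans (cong c (≈⇒%≡ (+-cong-≈ idx≈ (≈-refl {p})))) (h p p<k)) (reflectV-bits axis v p<k) ⟩
      asymmetry v p xor bits v (m ∸ p)                            ≡⟨ xor-cancelʳ (bits v p) _ ⟩
      bits v p                                                    ∎
      where
      idx≈ : idx (reflectV axis v) ≈ idx v
      idx≈ = +-cancelʳ-≈ (idx v) (≈-trans (reflectV-idx axis v) (≈-sym v+v≈axis))
    t≈s+k : idx t ≈ idx s + k
    t≈s+k = antipodal n≡k+k det
    fixes-s : translateV c (reflectV axis s) ≡ s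
    fixes-s = fixes-if s ≈-refl λ p p<k →
      trans (cong (λ d → if does (d <? k) then asymmetry s d else asymmetry t (d ∸ k))
              (offset (≈-refl {idx s + p}) (<-≤-trans p<k (subst (k ≤_) (sym n≡k+k) (m≤m+n k k)))))
            (cong (if_then asymmetry s p else asymmetry t (p ∸ k)) (dec-true (p <? k) p<k))
    fixes-t : translateV c (reflectV axis t) ≡ t
    fixes-t = fixes-if t t+t≈axis λ p p<k →
      trans (cong (λ d → if does (d <? k) then asymmetry s d else asymmetry t (d ∸ k))
              (offset (≈-trans (+-cong-≈ t≈s+k (≈-refl {p})) (≈-reflexive (+-assoc (idx s) k p)))
                (subst (k + p <_) (sym n≡k+k) (+-monoʳ-< k p<k))))
      (trans (cong (if_then asymmetry s (k + p) else asymmetry t (k + p ∸ k))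
               (dec-false (k + p <? k) (m+n≮m k p)))
             (cong (asymmetry t) (m+n∸m≡n k p)))
      where
      t+t≈axis : idx t + idx t ≈ axis
      t+t≈axis = ≈-trans (+-cong-≈ t≈s+k t≈s+k) (≈-trans (≈-reflexive (regroup (idx s) k))
        (≈-trans (+-cong-≈ (≈-refl {axis}) (≈-trans (≈-reflexive (sym n≡k+k)) n≈0))
                 (≈-reflexive (+-identityʳ axis))))
        where
        regroup : ∀ i k → (i + k) + (i + k) ≡ (i + i) + (k + k)
        regroup = solve-∀
    fixes : ∀ v → v ∈ s ∷ t ∷ [] → translateV c (reflectV axis v) ≡ v
    fixes v (here refl)         = fixes-s
    fixes v (there (here refl)) = fixes-t
    -- Any vertex with index next to that of `s` is moved: fixing it would give `2 ≈ 0`.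
    moved : V
    moved = O (suc (idx s))
    idx-moved : idx moved ≈ suc (idx s)
    idx-moved = toℕ-mod (suc (idx s))
    fixed-idx : idx moved + idx moved ≈ axis
    fixed-idx = ≈-trans
      (+-cong-≈ (≈-reflexive (cong idx (sym (det ψ fixes moved)))) (≈-refl {idx moved}))
      (reflectV-idx axis moved)

  3≤determining : 3 ≤ n → n ≡ k + k → ∀ S → IsDeterminingSet n k S → 3 ≤ length S
  3≤determining 3≤n n≡k+k [] det = ⊥-elim (n≮0 (<-≤-trans 3≤n (≤-trans (determining⇒n≤ det) z≤n)))
  3≤determining 3≤n n≡k+k (s ∷ []) det = ⊥-elim (<⇒≱ k<n (subst (n ≤_) (*-identityˡ k) (determining⇒n≤ det)))
    where
    k<n : k < n
    k<n = subst (k <_) (sym n≡k+k) (m<m+n k z<s)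
  3≤determining 3≤n n≡k+k (s ∷ t ∷ []) det = ⊥-elim (pair-¬determining 3≤n n≡k+k det)
  3≤determining _ _ (_ ∷ _ ∷ _ ∷ _) _ = s≤s (s≤s (s≤s z≤n))

  -- Upper bound for n other than 4

  module _ (3≤n : 3 ≤ n) (1≤m : 1 ≤ m) (k<n : k < n) where

    0<n : 0 < n
    0<n = <-≤-trans z<s 3≤n

    k≤n : k ≤ n
    k≤n = <⇒≤ k<n

    -- Reduces the task to windows of zero vertices; `j + j ≉ 0` says that `j` is neither 0 nor
    -- antipodal to it.
    O∈⇒determining : n ≢ 4 → ∀ S → O 0 ∈ S → (∃ λ j → j + j ≉ 0 × O j ∈ S) →
      (∀ t → ∃ λ j → ∃ λ q → q < k × j + q ≈ t × O j ∈ S) → IsDeterminingSet n k S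
    O∈⇒determining n≢4 S 0∈S (j , j+j≉0 , j∈S) cover φ fixes =
      Action.fixes-all φ 3≤n n≢4 1≤m k≤n (fixes _ 0∈S) j j+j≉0 (fixes _ j∈S)
        λ t → let i , q , q<k , i+q≈t , i∈S = cover t in i , q , q<k , i+q≈t , fixes _ i∈S

    O-injective : ∀ {i j} → i < n → j < n → O i ≡ O j → i ≡ j
    O-injective {i} {j} i<n j<n e =
      ≈⇒≡ i<n j<n (≈-trans (≈-sym (toℕ-mod i)) (≈-trans (≈-reflexive (cong idx e)) (toℕ-mod j)))

    -- As `0 < k + k < n + n`, the only multiple of `n` it could be is `n` itself.
    k+k≉0 : k + k ≢ n → k + k ≉ 0
    k+k≉0 k+k≢n e with <-cmp (k + k) n
    ... | tri< k+k<n _ _ with () ← ≈⇒≡ k+k<n 0<n e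
    k+k≉0 k+k≢n e | tri≈ _ k+k≡n _ = k+k≢n k+k≡n
    k+k≉0 k+k≢n e | tri> _ _ n<k+k = <⇒≢ (m<n⇒0<n∸m n<k+k) (sym (≈⇒≡ rest<n 0<n rest≈0))
      where
      split : n + (k + k ∸ n) ≡ k + k
      split = m+[n∸m]≡n (<⇒≤ n<k+k)
      rest<n : k + k ∸ n < n
      rest<n = +-cancelˡ-< n _ _ (subst (_< n + n) (sym split) (+-mono-< k<n k<n))
      rest≈0 : k + k ∸ n ≈ 0
      rest≈0 = +-cancelˡ-≈ n (≈-trans (≈-reflexive split) (≈-trans e (≈-trans (≈-sym n≈0) (≈-reflexive (sym (+-identityʳ n))))))

    d : ℕ
    d = ceilDiv n k

    n≤d*k : n ≤ d * k
    n≤d*k = +-cancelˡ-≤ m n (d * k) (begin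
      m + n                   ≡⟨ +-comm m n ⟩
      n + m                   ≡⟨ m≡m%n+[m/n]*n (n + m) k ⟩
      (n + m) % k + d * k     ≤⟨ +-monoˡ-≤ (d * k) (≤-pred (m%n<n (n + m) k)) ⟩
      m + d * k               ∎)
      where open ≤-Reasoning

    -- Consecutive windows around the cycle; the last one may wrap past 0.
    blocks : List V
    blocks = applyUpTo (λ j → O (j * k)) d

    block<n : ∀ {j} → j < d → j * k < n
    block<n {j} j<d = +-cancelˡ-≤ m (suc (j * k)) n (begin
      m + suc (j * k)   ≡⟨ +-suc m (j * k) ⟩
      suc j * k         ≤⟨ *-monoˡ-≤ k j<d ⟩
      d * k             ≤⟨ m/n*n≤m (n + m) k ⟩
      n + m             ≡⟨ +-comm n m ⟩
      m + n             ∎)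
      where open ≤-Reasoning

    blocks-unique : Unique blocks
    blocks-unique = applyUpTo⁺₁ (λ j → O (j * k)) d λ {i} {j} i<j j<d e →
      <⇒≢ i<j (*-cancelʳ-≡ i j k (O-injective (block<n (<-trans i<j j<d)) (block<n j<d) e))

    blocks-determining : n ≢ 4 → k + k ≢ n → IsDeterminingSet n k blocks
    blocks-determining n≢4 k+k≢n = O∈⇒determining n≢4 blocks (∈-applyUpTo⁺ _ (<-trans z<s 1<d))
      -- The second block, starting at `k`, excludes the reflection.
      (1 * k , subst (λ j → j + j ≉ 0) (sym (*-identityˡ k)) (k+k≉0 k+k≢n) , ∈-applyUpTo⁺ _ 1<d)
      cover
      where
      1<d : 1 < d
      1<d = *-cancelʳ-< k 1 d (subst (_< d * k) (sym (*-identityˡ k)) (<-≤-trans k<n n≤d*k))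
      cover : ∀ t → ∃ λ j → ∃ λ q → q < k × j + q ≈ t × O j ∈ blocks
      cover t = r / k * k , r % k , m%n<n r k ,
        ≈-trans (≈-reflexive (trans (+-comm (r / k * k) (r % k)) (sym (m≡m%n+[m/n]*n r k)))) (%-≈ t) ,
        ∈-applyUpTo⁺ _ (m<n*o⇒m/o<n (<-≤-trans (m%n<n t n) n≤d*k))
        where
        r : ℕ
        r = t % n

    -- For `n ≡ k + k` the windows of `O 0` and `O k` already cover, but they are antipodal; `O 1`
    -- excludes the reflection.
    triple : List V
    triple = O 0 ∷ O 1 ∷ O k ∷ []

    triple-unique : Unique triple
    triple-unique =
      (O-≢ 0<n 1<n (λ ()) ∷ O-≢ 0<n k<n (λ ()) ∷ []) ∷ (O-≢ 1<n k<n (<⇒≢ (s≤s 1≤m)) ∷ []) ∷ [] ∷ []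
      where
      1<n : 1 < n
      1<n = <-≤-trans (s<s z<s) 3≤n
      O-≢ : ∀ {i j} → i < n → j < n → i ≢ j → O i ≢ O j
      O-≢ i<n j<n i≢j e = i≢j (O-injective i<n j<n e)

    triple-determining : n ≢ 4 → n ≡ k + k → IsDeterminingSet n k triple
    triple-determining n≢4 n≡k+k = O∈⇒determining n≢4 triple (here refl)
      (1 , 2≉0 3≤n , there (here refl)) cover
      where
      cover : ∀ t → ∃ λ j → ∃ λ q → q < k × j + q ≈ t × O j ∈ triple
      cover t with t % n <? k
      ... | yes r<k = 0 , t % n , r<k , %-≈ t , here refl
      ... | no  r≮k = k , t % n ∸ k ,
        +-cancelˡ-< k _ _ (subst₂ _<_ (sym (m+[n∸m]≡n (≮⇒≥ r≮k))) n≡k+k (m%n<n t n)) ,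
        ≈-trans (≈-reflexive (m+[n∸m]≡n (≮⇒≥ r≮k))) (%-≈ t) , there (there (here refl))

    Det-generic : n ≢ 4 → k + k ≢ n → DetNumberIs n k d
    Det-generic n≢4 k+k≢n =
      (blocks , blocks-unique , length-applyUpTo _ d , blocks-determining n≢4 k+k≢n) ,
      λ S _ det → ceilDiv-≤ (determining⇒n≤ det)

    Det-antipodal : n ≢ 4 → n ≡ k + k → DetNumberIs n k 3
    Det-antipodal n≢4 n≡k+k =
      (triple , triple-unique , refl , triple-determining n≢4 n≡k+k) ,
      λ S _ → 3≤determining 3≤n n≡k+k S

-- Enumeration and decidable adjacency

bitstrings : ∀ k → List (Vec Bool k)
bitstrings zero    = [] ∷ []
bitstrings (suc k) = cartesianProductWith _∷_ (false ∷ true ∷ []) (bitstrings k)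

∈-bitstrings : ∀ {k} (x : Vec Bool k) → x ∈ bitstrings k
∈-bitstrings []      = here refl
∈-bitstrings (a ∷ x) = ∈-cartesianProductWith⁺ _∷_ (∈-Bool a) (∈-bitstrings x)
  where
  ∈-Bool : ∀ a → a ∈ false ∷ true ∷ []
  ∈-Bool false = here refl
  ∈-Bool true  = there (here refl)

IsSucc? : ∀ {n} (i j : Fin n) → Dec (IsSucc i j)
IsSucc? {n} i j = (suc (toℕ i) ≟ toℕ j) ⊎-dec ((suc (toℕ i) ≟ n) ×-dec (toℕ j ≟ 0))

Shift? : ∀ {k} (x y : Vec Bool k) → Dec (Shift x y)
Shift? {zero}  x       y = yes tt
Shift? {suc m} (a ∷ z) y = map′
  -- `a` and `z` are read off the first string, so only the last bit is left to try.
  [ (λ e → a , false , z , refl , e) , (λ e → a , true , z , refl , e) ]′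
  (λ { (_ , false , _ , refl , e) → inj₁ e ; (_ , true , _ , refl , e) → inj₂ e })
  (Vec.≡-dec Bool._≟_ y (z ∷ʳ false) ⊎-dec Vec.≡-dec Bool._≟_ y (z ∷ʳ true))

Arc? : ∀ {n k} (u v : Vertex n k) → Dec (Arc u v)
Arc? (i , x) (j , y) = IsSucc? i j ×-dec Shift? x y

-- Certificates that a set is determining

module Pinning (n m : ℕ) {{_ : NonZero n}} where

  open PX n m using (k; V; module Action)

  vertices : List V
  vertices = cartesianProduct (allFin n) (bitstrings k)

  ∈-vertices : ∀ v → v ∈ vertices
  ∈-vertices (i , x) = ∈-cartesianProduct⁺ (∈-allFin i) (∈-bitstrings x)

  ∀? : {P : V → Set} → (∀ v → Dec (P v)) → Dec (∀ v → P v)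
  ∀? P? = map′ (λ all v → All.lookup all (∈-vertices v)) (λ h → All.tabulate λ {v} _ → h v)
    (All.all? P? vertices)

  ∃? : {P : V → Set} → (∀ v → Dec (P v)) → Dec (∃ P)
  ∃? P? = map′ Any.satisfied (λ (v , p) → lose (∈-vertices v) p) (Any.any? P? vertices)

  _≟ⱽ_ : (u v : V) → Dec (u ≡ v)
  _≟ⱽ_ = Product.≡-dec Fin._≟_ (Vec.≡-dec Bool._≟_)

  Adj? : ∀ u v → Dec (Adj n k u v)
  Adj? u v = Arc? u v ⊎-dec Arc? v u

  -- Relations to a base vertex that survive every automorphism fixing that base.
  data Constraint : Set where
    near across apart : V → Constraint

  base : Constraint → V
  base (near b)   = b
  base (across b) = b
  base (apart b)  = b

  Between : V → V → V → Set
  Between u v t = Adj n k u t × Adj n k t v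

  Between? : ∀ u v t → Dec (Between u v t)
  Between? u v t = Adj? u t ×-dec Adj? t v

  infix 4 _⊨_ _⊨?_
  _⊨_ : V → Constraint → Set
  v ⊨ near b   = Adj n k b v
  -- v lies straight across b: in PX(4,3), where every edge is in exactly two 4-cycles, these are
  -- the two-step walks that are not part of a 4-cycle.
  v ⊨ across b = ∃ λ t → Between b v t × ∀ t′ → Between b v t′ → t′ ≡ t
  v ⊨ apart b  = v ≢ b

  _⊨?_ : ∀ v c → Dec (v ⊨ c)
  v ⊨? near b   = Adj? b v
  v ⊨? across b = ∃? λ t → Between? b v t ×-dec ∀? λ t′ → Between? b v t′ →-dec (t′ ≟ⱽ t)
  v ⊨? apart b  = ¬? (v ≟ⱽ b)

  Step : Set
  Step = V × List Constraint

  Justified : List V → Step → Set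
  Justified F (w , cs) =
    All (λ c → base c ∈ F) cs × All (w ⊨_) cs × (∀ v → All (v ⊨_) cs → v ≡ w)

  Justified? : ∀ F s → Dec (Justified F s)
  Justified? F (w , cs) = All.all? (λ c → Any.any? (base c ≟ⱽ_) F) cs
    ×-dec All.all? (w ⊨?_) cs
    ×-dec ∀? λ v → All.all? (v ⊨?_) cs →-dec (v ≟ⱽ w)

  Pins : List V → List Step → Set
  Pins F []       = ∀ v → v ∈ F
  Pins F (s ∷ ss) = Justified F s × Pins (proj₁ s ∷ F) ss

  Pins? : ∀ F ss → Dec (Pins F ss)
  Pins? F []       = ∀? λ v → Any.any? (v ≟ⱽ_) F
  Pins? F (s ∷ ss) = Justified? F s ×-dec Pins? (proj₁ s ∷ F) ss

  -- The image of `w` satisfies the same constraints over the same fixed bases, so it is `w` by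
  -- uniqueness; `w` then joins the fixed vertices.
  Pins⇒determining : ∀ {F} ss → Pins F ss → IsDeterminingSet n k F
  Pins⇒determining {F} []             pins φ fixes v = fixes v (pins v)
  Pins⇒determining {F} ((w , cs) ∷ ss) ((bases , sat , unique) , pins) φ fixes =
    Pins⇒determining ss pins φ λ { v (here refl) → fixes-w ; v (there v∈F) → fixes v v∈F }
    where
    open Action φ
    open Inverse (Automorphism.perm φ) using (from; strictlyInverseˡ)
    preserve-⊨ : ∀ c → base c ∈ F → w ⊨ c → f w ⊨ c
    preserve-⊨ (near b) b∈F bw = subst (λ u → Adj n k u (f w)) (fixes b b∈F) (f-Adj bw)
    preserve-⊨ (apart b) b∈F w≢b e = w≢b (f-injective (trans e (sym (fixes b b∈F))))
    preserve-⊨ (across b) b∈F (t , (bt , tw) , only-t) =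
      f t , (subst (λ u → Adj n k u (f t)) (fixes b b∈F) (f-Adj bt) , f-Adj tw) ,
      -- A midpoint between the images is pulled back by `from`, where the midpoint is unique.
      λ { t′ (bt′ , t′w) → trans (sym (strictlyInverseˡ t′)) (cong f (only-t (from t′)
        ( f-Adj⁻ (subst₂ (Adj n k) (sym (fixes b b∈F)) (sym (strictlyInverseˡ t′)) bt′)
        , f-Adj⁻ (subst (λ u → Adj n k u (f w)) (sym (strictlyInverseˡ t′)) t′w)))) }
    fixes-w : f w ≡ w
    fixes-w = unique (f w) (All.zipWith (λ { {c} (c∈F , w⊨c) → preserve-⊨ c c∈F w⊨c }) (bases , sat))

-- The two graphs with n = 4

pattern #0 = false
pattern #1 = true

-- This set and S₄₃ were found by computer search.
S₄₂ : List (Vertex 4 2)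
S₄₂ = (0F , #0 ∷ #0 ∷ []) ∷ (0F , #0 ∷ #1 ∷ []) ∷ (2F , #0 ∷ #0 ∷ []) ∷ []

S₄₂-determining : IsDeterminingSet 4 2 S₄₂
-- The certificate `steps` is checked by evaluating the decision procedure.
S₄₂-determining = Pins⇒determining steps (toWitness {a? = Pins? S₄₂ steps} tt)
  where
  open Pinning 4 1
  at : Fin 4 → Bool → Bool → Vertex 4 2
  at j a b = j , a ∷ b ∷ []
  steps : List Step
  steps =
      (at 3F #0 #0 , near (at 0F #0 #0) ∷ near (at 0F #0 #1) ∷ near (at 2F #0 #0) ∷ [])
    ∷ (at 1F #0 #0 , near (at 0F #0 #0) ∷ near (at 2F #0 #0) ∷ apart (at 3F #0 #0) ∷ [])
    ∷ (at 1F #1 #0 , near (at 0F #0 #1) ∷ near (at 2F #0 #0) ∷ apart (at 3F #0 #0) ∷ [])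
    ∷ (at 2F #0 #1 , near (at 1F #0 #0) ∷ near (at 1F #1 #0) ∷ apart (at 2F #0 #0) ∷ [])
    ∷ (at 3F #1 #0 , near (at 0F #0 #0) ∷ near (at 0F #0 #1) ∷ near (at 2F #0 #1) ∷ [])
    ∷ (at 0F #1 #0 , near (at 1F #0 #0) ∷ apart (at 0F #0 #0) ∷ apart (at 2F #0 #0) ∷ apart (at 2F #0 #1) ∷ [])
    ∷ (at 1F #0 #1 , near (at 0F #0 #0) ∷ near (at 0F #1 #0) ∷ apart (at 1F #0 #0) ∷ [])
    ∷ (at 2F #1 #0 , near (at 3F #0 #0) ∷ near (at 1F #0 #1) ∷ apart (at 0F #0 #0) ∷ [])
    ∷ (at 1F #1 #1 , near (at 0F #0 #1) ∷ near (at 2F #1 #0) ∷ apart (at 3F #0 #0) ∷ [])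
    ∷ (at 0F #1 #1 , near (at 1F #1 #0) ∷ near (at 1F #1 #1) ∷ apart (at 0F #0 #1) ∷ [])
    ∷ (at 2F #1 #1 , near (at 3F #1 #0) ∷ near (at 1F #0 #1) ∷ near (at 1F #1 #1) ∷ [])
    ∷ (at 3F #0 #1 , near (at 2F #0 #0) ∷ near (at 0F #1 #0) ∷ near (at 2F #1 #0) ∷ [])
    ∷ (at 3F #1 #1 , near (at 2F #0 #1) ∷ near (at 0F #1 #0) ∷ near (at 0F #1 #1) ∷ [])
    ∷ []

S₄₃ : List (Vertex 4 3)
S₄₃ = (0F , #0 ∷ #0 ∷ #0 ∷ []) ∷ (1F , #0 ∷ #1 ∷ #0 ∷ []) ∷ []

S₄₃-determining : IsDeterminingSet 4 3 S₄₃
S₄₃-determining = Pins⇒determining steps (toWitness {a? = Pins? S₄₃ steps} tt)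
  where
  open Pinning 4 2
  at : Fin 4 → Bool → Bool → Bool → Vertex 4 3
  at j a b c = j , a ∷ b ∷ c ∷ []
  steps : List Step
  steps =
      (at 3F #1 #0 #0 , near (at 0F #0 #0 #0) ∷ across (at 1F #0 #1 #0) ∷ [])
    ∷ (at 0F #0 #0 #1 , near (at 1F #0 #1 #0) ∷ near (at 3F #1 #0 #0) ∷ [])
    ∷ (at 1F #0 #0 #0 , near (at 0F #0 #0 #0) ∷ across (at 3F #1 #0 #0) ∷ [])
    ∷ (at 2F #1 #0 #0 , near (at 1F #0 #1 #0) ∷ across (at 0F #0 #0 #0) ∷ [])
    ∷ (at 3F #0 #0 #0 , near (at 0F #0 #0 #0) ∷ near (at 2F #1 #0 #0) ∷ [])
    ∷ (at 1F #0 #0 #1 , near (at 0F #0 #0 #0) ∷ across (at 3F #0 #0 #0) ∷ [])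
    ∷ (at 0F #1 #0 #1 , near (at 1F #0 #1 #0) ∷ across (at 2F #1 #0 #0) ∷ [])
    ∷ (at 2F #1 #0 #1 , near (at 1F #0 #1 #0) ∷ across (at 0F #0 #0 #1) ∷ [])
    ∷ (at 2F #0 #1 #0 , near (at 3F #1 #0 #0) ∷ across (at 0F #0 #0 #1) ∷ [])
    ∷ (at 2F #1 #1 #0 , near (at 3F #1 #0 #0) ∷ across (at 0F #0 #0 #0) ∷ [])
    ∷ (at 1F #0 #1 #1 , near (at 0F #1 #0 #1) ∷ near (at 2F #1 #1 #0) ∷ [])
    ∷ (at 0F #1 #0 #0 , near (at 1F #0 #0 #0) ∷ across (at 2F #1 #0 #1) ∷ [])
    ∷ (at 3F #0 #1 #0 , near (at 2F #1 #0 #1) ∷ near (at 0F #1 #0 #0) ∷ [])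
    ∷ (at 2F #0 #0 #0 , near (at 1F #0 #0 #0) ∷ across (at 0F #0 #0 #1) ∷ [])
    ∷ (at 2F #0 #0 #1 , near (at 1F #0 #0 #0) ∷ across (at 0F #0 #0 #0) ∷ [])
    ∷ (at 1F #1 #1 #0 , near (at 2F #1 #0 #0) ∷ across (at 3F #0 #0 #0) ∷ [])
    ∷ (at 3F #0 #0 #1 , near (at 2F #1 #0 #0) ∷ across (at 1F #0 #1 #0) ∷ [])
    ∷ (at 2F #0 #1 #1 , near (at 1F #0 #0 #1) ∷ across (at 0F #0 #0 #0) ∷ [])
    ∷ (at 3F #1 #1 #0 , near (at 0F #1 #0 #1) ∷ near (at 2F #0 #1 #1) ∷ [])
    ∷ (at 3F #0 #1 #1 , near (at 2F #1 #0 #1) ∷ across (at 1F #0 #1 #0) ∷ [])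
    ∷ (at 1F #1 #0 #1 , near (at 2F #0 #1 #0) ∷ across (at 3F #1 #0 #0) ∷ [])
    ∷ (at 0F #0 #1 #0 , near (at 3F #0 #0 #1) ∷ near (at 1F #1 #0 #1) ∷ [])
    ∷ (at 3F #1 #0 #1 , near (at 2F #1 #1 #0) ∷ near (at 0F #0 #1 #0) ∷ [])
    ∷ (at 1F #1 #0 #0 , near (at 2F #0 #0 #1) ∷ near (at 0F #0 #1 #0) ∷ [])
    ∷ (at 0F #0 #1 #1 , near (at 1F #1 #1 #0) ∷ near (at 3F #1 #0 #1) ∷ [])
    ∷ (at 0F #1 #1 #0 , near (at 3F #0 #1 #1) ∷ near (at 1F #1 #0 #1) ∷ [])
    ∷ (at 1F #1 #1 #1 , near (at 2F #1 #1 #0) ∷ across (at 3F #1 #0 #0) ∷ [])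
    ∷ (at 2F #1 #1 #1 , near (at 3F #1 #1 #0) ∷ near (at 1F #1 #1 #1) ∷ [])
    ∷ (at 0F #1 #1 #1 , near (at 3F #0 #1 #1) ∷ near (at 1F #1 #1 #1) ∷ [])
    ∷ (at 3F #1 #1 #1 , near (at 2F #0 #1 #1) ∷ near (at 0F #1 #1 #1) ∷ [])
    ∷ []

-- The general lower bound covers `n = 4` as well; only the upper bound rests on the explicit set.
Det₄₂ : DetNumberIs 4 2 3
Det₄₂ = (S₄₂ , unique , refl , S₄₂-determining) ,
  λ S _ → PX.3≤determining 4 1 (s≤s (s≤s (s≤s z≤n))) refl S
  where
  unique : Unique S₄₂
  unique = ((λ ()) ∷ (λ ()) ∷ []) ∷ ((λ ()) ∷ []) ∷ [] ∷ []

Det₄₃ : DetNumberIs 4 3 2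
Det₄₃ = (S₄₃ , ((λ ()) ∷ []) ∷ [] ∷ [] , refl , S₄₃-determining) ,
  λ S _ det → PX.ceilDiv-≤ 4 2 (PX.determining⇒n≤ 4 2 det)

-- Assembling the cases

ceilDiv-double : ∀ m → ceilDiv (suc m + suc m) (suc m) ≡ 2
ceilDiv-double m = ≤-antisym
  (PX.ceilDiv-≤ (suc m + suc m) m (≤-reflexive (cong (suc m +_) (sym (+-identityʳ (suc m))))))
  (subst (_≤ ceilDiv (suc m + suc m) (suc m)) (m*n/n≡m 2 (suc m)) (/-monoˡ-≤ (suc m) (≤-trans (≤-reflexive (cong (suc m +_) (+-identityʳ (suc m)))) (m≤m+n _ m))))

theorem4p5 : (n k : ℕ) → 3 ≤ n → 2 ≤ k → k < n →
    ((2 * k ≢ n → DetNumberIs n k (ceilDiv n k))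
    × (2 * k ≡ n → DetNumberIs n k (ceilDiv n k + 1) × ceilDiv n k + 1 ≡ 3))
theorem4p5 n@(suc _) k@(suc m) 3≤n (s≤s 1≤m) k<n = generic , antipodal
  where
  open PX n m using (Det-generic; Det-antipodal)
  2*k≡k+k : 2 * k ≡ k + k
  2*k≡k+k = cong (k +_) (+-identityʳ k)
  4-cases : n ≡ 4 → k ≡ 2 ⊎ k ≡ 3
  4-cases refl with m≤n⇒m<n∨m≡n 1≤m
  ... | inj₂ refl = inj₁ refl
  ... | inj₁ 1<m  = inj₂ (≤-antisym (≤-pred k<n) (s≤s 1<m))
  generic : 2 * k ≢ n → DetNumberIs n k (ceilDiv n k)
  generic 2*k≢n with n ≟ 4
  ... | no n≢4 = Det-generic 3≤n 1≤m k<n n≢4 (2*k≢n ∘ trans 2*k≡k+k)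
  ... | yes n≡4 with n≡4 | 4-cases n≡4
  -- For `n = 4` the value `k = 2` is the antipodal case, so only `k = 3` remains here.
  ...   | refl | inj₁ refl = ⊥-elim (2*k≢n refl)
  ...   | refl | inj₂ refl = Det₄₃
  antipodal : 2 * k ≡ n → DetNumberIs n k (ceilDiv n k + 1) × ceilDiv n k + 1 ≡ 3
  antipodal 2*k≡n = subst (DetNumberIs n k) (sym count) exactly3 , count
    where
    n≡k+k : n ≡ k + k
    n≡k+k = trans (sym 2*k≡n) 2*k≡k+k
    count : ceilDiv n k + 1 ≡ 3
    count = cong (_+ 1) (trans (cong (λ l → ceilDiv l k) n≡k+k) (ceilDiv-double m))
    exactly3 : DetNumberIs n k 3
    exactly3 with n ≟ 4
    ... | no n≢4 = Det-antipodal 3≤n 1≤m k<n n≢4 n≡k+k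
    ... | yes n≡4 with n≡4 | 4-cases n≡4
    ...   | refl | inj₁ refl = Det₄₂
    ...   | refl | inj₂ refl with () ← n≡k+k
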